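{- The bound $D\le \frac{4(n-1)-m}{3}$ for connected planar graphs is best possible up to an additive constant for all possible values of $m$ and $n$: there is a constant $C$ such that for all integers $n\ge 3$ and $m$ with $n-1\le m\le 3n-6$ there exists a finite simple connected planar graph $G$ with exactly $n$ vertices and $m$ edges such that $D(G)\ge \frac{4(n-1)-m}{3}-C$.
   Context: $D(G)$ is the diameter of $G$: the maximum over all pairs of vertices of the distance (minimum number of edges on a path) between them. -}

module Defs where

open import Data.Nat using (ℕ; zero; suc; _≤_)
open import Data.Integer using (+_)
import Data.Integer as ℤ
open import Data.Rational as ℚ using (ℚ; 0ℚ; 1ℚ)
open import Data.Fin using (Fin; _<_)
open import Data.Fin.Properties using (_<?_)
open import Data.List using (List; []; _∷_; length; filter; allFin; cartesianProduct)
open import Data.List.Relation.Unary.Unique.Propositional using (Unique)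
open import Data.Product using (∃-syntax; _×_; _,_)
open import Data.Sum using (_⊎_)
open import Level using (0ℓ)
open import Relation.Binary using (Rel; Symmetric; Irreflexive; Decidable)
open import Relation.Binary.Construct.Closure.ReflexiveTransitive using (Star; ε; _◅_)
open import Relation.Binary.PropositionalEquality using (_≡_; _≢_)
open import Relation.Nullary using (Dec)
open import Relation.Nullary.Decidable using (_×-dec_)

record Graph (n : ℕ) : Set₁ where
  infix 4 _~_ _~?_
  field
    _~_      : Rel (Fin n) 0ℓ
    ~-sym    : Symmetric _~_
    ~-irrefl : Irreflexive _≡_ _~_
    _~?_     : Decidable _~_

module _ {n : ℕ} (G : Graph n) where
  open Graph G

  -- The unordered edge {u, v} is represented by the pair (u, v) with u < v.
  IsEdge : Fin n × Fin n → Set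
  IsEdge (u , v) = u < v × u ~ v

  isEdge? : (e : Fin n × Fin n) → Dec (IsEdge e)
  isEdge? (u , v) = (u <? v) ×-dec (u ~? v)

  numEdges : ℕ
  numEdges = length (filter isEdge? (cartesianProduct (allFin n) (allFin n)))

  Walk : Fin n → Fin n → Set
  Walk = Star _~_

  walkLength : ∀ {u v} → Walk u v → ℕ
  walkLength ε       = zero
  walkLength (_ ◅ w) = suc (walkLength w)

  vertices : ∀ {u v} → Walk u v → List (Fin n)
  vertices {u} ε       = u ∷ []
  vertices {u} (_ ◅ w) = u ∷ vertices w

  record Path (u v : Fin n) : Set where
    field
      walk     : Walk u v
      distinct : Unique (vertices walk)

  pathLength : ∀ {u v} → Path u v → ℕ
  pathLength p = walkLength (Path.walk p)

  Connected : Set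
  Connected = ∀ u v → Path u v

  IsDistance : Fin n → Fin n → ℕ → Set
  IsDistance u v d =
    (∃[ p ] pathLength {u} {v} p ≡ d) × (∀ (p : Path u v) → d ≤ pathLength p)

  -- For connected G every pair of vertices has a distance, so this is the
  -- maximum over all pairs.
  IsDiameter : ℕ → Set
  IsDiameter D =
    (∃[ u ] ∃[ v ] IsDistance u v D) × (∀ u v d → IsDistance u v d → d ≤ D)

-- Planarity is stated by drawings in which edges are polygonal arcs with
-- finitely many corners, all corners having rational coordinates.  Points are
-- taken in ℚ²: if two segments with endpoints in ℚ² meet in ℝ², they meet in
-- ℚ² and, if they have more than one point in common, they have more than one
-- rational point in common.  Hence the conditions below say the same as the
-- corresponding ones over ℝ, and such a drawing is a drawing in the real plane.

Point : Set
Point = ℚ × ℚ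

OnSegment : Point → Point → Point → Set
OnSegment (ax , ay) (bx , by) (px , py) =
  ∃[ t ] 0ℚ ℚ.≤ t × t ℚ.≤ 1ℚ
       × px ≡ (1ℚ ℚ.- t) ℚ.* ax ℚ.+ t ℚ.* bx
       × py ≡ (1ℚ ℚ.- t) ℚ.* ay ℚ.+ t ℚ.* by

-- The polygonal line from a to b whose successive inner corners are cs.
OnPolyline : Point → List Point → Point → Point → Set
OnPolyline a []       b p = OnSegment a b p
OnPolyline a (c ∷ cs) b p = OnSegment a c p ⊎ OnPolyline c cs b p

-- The polygonal line does not touch itself: each segment is nondegenerate and
-- meets the part after it only in their common corner.
IsArc : Point → List Point → Point → Set
IsArc a []       b = a ≢ b
IsArc a (c ∷ cs) b =
  a ≢ c × (∀ p → OnSegment a c p → OnPolyline c cs b p → p ≡ c) × IsArc c cs b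

record PlaneDrawing {n : ℕ} (G : Graph n) : Set where
  field
    pos           : Fin n → Point
    pos-injective : ∀ {u v} → pos u ≡ pos v → u ≡ v
    corners       : Fin n × Fin n → List Point

  OnEdge : Fin n × Fin n → Point → Set
  OnEdge (u , v) = OnPolyline (pos u) (corners (u , v)) (pos v)

  Incident : Fin n → Fin n × Fin n → Set
  Incident w (u , v) = w ≡ u ⊎ w ≡ v

  field
    edge-arc       : ∀ u v → IsEdge G (u , v) →
                     IsArc (pos u) (corners (u , v)) (pos v)
    vertex-on-edge : ∀ w e → IsEdge G e → OnEdge e (pos w) → Incident w e
    no-crossing    : ∀ e f → IsEdge G e → IsEdge G f → e ≢ f →
                     ∀ p → OnEdge e p → OnEdge f p →
                     ∃[ w ] Incident w e × Incident w f × p ≡ pos w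

Planar : ∀ {n} → Graph n → Set
Planar = PlaneDrawing

diameterBound : ℕ → ℕ → ℚ
diameterBound n m = (+ 4 ℤ.* (+ n ℤ.- + 1) ℤ.- + m) ℚ./ 3

{-# OPTIONS --safe #-}

-- On the vertices 0, …, n - 1 join i to i + 1, and add e = m - (n - 1) further
-- edges of the form {i, i + 2} or {i, i + 3}, as near to 0 as possible.  Along
-- each edge v + max(0, 2v - e - 4) changes by at most 3, and its values at the
-- two ends of the path give D ≥ (4(n - 1) - m - 4) / 3.
--
-- All edges are also edges of the cube of a path, which consists of nested
-- triangles: put vertex v on the ray with number v mod 3 out of three rays from
-- the origin, at a radius that grows along each ray, and draw straight edges.
-- The plane with its three rays is a picture of the boundary of the octant of
-- ℚ³, and there the planes through three consecutive vertices separate edges.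

module Submission where

open import Defs
open import Data.Bool using (true; false; if_then_else_)
open import Data.Fin using (Fin; zero; suc; toℕ; inject₁; fromℕ)
open import Data.Product using (Σ; ∃; ∃-syntax; _×_; _,_; proj₁; proj₂; map₂)
open import Data.Sum as Sum using (_⊎_; inj₁; inj₂; swap)
open import Relation.Binary using (Rel; Tri; tri<; tri≈; tri>)
open import Relation.Binary.PropositionalEquality
  using (_≡_; _≢_; refl; sym; trans; cong; cong₂; subst; subst₂; module ≡-Reasoning)
open import Relation.Nullary using (Dec; yes; no; does; ¬_; contradiction; map′)

-- Drawing the cube of a path on three rays: levels and radii.

module SpiralDrawing where

  import Data.Fin.Properties as Fin
  open import Data.Nat as ℕ using (ℕ; zero; suc; z≤n; s≤s)
  import Data.Nat.Properties as ℕ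
  open import Data.Product.Properties using (,-injective)
  open import Data.Rational
    using (ℚ; 0ℚ; 1ℚ; _+_; _*_; _-_; -_; _≤_; _<_; 1/_; Positive; NonZero; positive; nonNegative)
  open import Data.Rational.Properties
  open import Data.Rational.Solver using (module +-*-Solver)

  ray : ℕ → Fin 3
  ray 0                   = zero
  ray 1                   = suc zero
  ray 2                   = suc (suc zero)
  ray (suc (suc (suc v))) = ray v

  -- below k c is the number of v < k with ray v ≡ c.
  below : ℕ → Fin 3 → ℕ
  below 0 _                   = 0
  below 1 zero                = 1
  below 1 (suc _)             = 0
  below 2 zero                = 1
  below 2 (suc zero)          = 1
  below 2 (suc (suc _))       = 0
  below (suc (suc (suc k))) c = suc (below k c)

  level : ℕ → ℕ
  level v = below v (ray v)

  below-step : ∀ k c → below k c ℕ.≤ below (suc k) c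
  below-step 0 _                   = z≤n
  below-step 1 zero                = s≤s z≤n
  below-step 1 (suc _)             = z≤n
  below-step 2 zero                = s≤s z≤n
  below-step 2 (suc zero)          = s≤s z≤n
  below-step 2 (suc (suc _))       = z≤n
  below-step (suc (suc (suc k))) c = s≤s (below-step k c)

  below-suc-ray : ∀ v → below (suc v) (ray v) ≡ suc (level v)
  below-suc-ray 0                   = refl
  below-suc-ray 1                   = refl
  below-suc-ray 2                   = refl
  below-suc-ray (suc (suc (suc v))) = cong suc (below-suc-ray v)

  below-mono : ∀ {k l} → k ℕ.≤ l → ∀ c → below k c ℕ.≤ below l c
  below-mono k≤l c = go (ℕ.≤⇒≤′ k≤l)
    where
    go : ∀ {k l} → k ℕ.≤′ l → below k c ℕ.≤ below l c
    go (ℕ.≤′-reflexive refl) = ℕ.≤-refl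
    go (ℕ.≤′-step k≤l)       = ℕ.≤-trans (go k≤l) (below-step _ c)

  -- Strict because `v` itself is counted by `below k` but not by `level v`.
  <⇒level< : ∀ {v k} → v ℕ.< k → level v ℕ.< below k (ray v)
  <⇒level< {v} {k} v<k = subst (ℕ._≤ below k (ray v)) (below-suc-ray v) (below-mono v<k (ray v))

  ≤⇒≤level : ∀ {v k} → k ℕ.≤ v → below k (ray v) ℕ.≤ level v
  ≤⇒≤level {v} k≤v = below-mono k≤v (ray v)

  -- Recursive rather than a cast from ℕ, so that positivity and monotonicity are inductions; it
  -- starts at 1 so that reciprocals always exist.
  radius : ℕ → ℚ
  radius zero    = 1ℚ
  radius (suc q) = 1ℚ + radius q

  radius-pos : ∀ q → Positive (radius q)
  radius-pos zero    = _
  radius-pos (suc q) = pos+pos⇒pos 1ℚ (radius q) {{radius-pos q}}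

  radius-nonZero : ∀ q → NonZero (radius q)
  radius-nonZero q = pos⇒nonZero (radius q) {{radius-pos q}}

  1/radius : ℕ → ℚ
  1/radius q = (1/ radius q) {{radius-nonZero q}}

  radius-step : ∀ q → radius q < radius (suc q)
  radius-step q = subst (_< radius (suc q)) (+-identityˡ (radius q))
                        (+-monoˡ-< (radius q) (positive⁻¹ 1ℚ))

  radius-mono-≤ : ∀ {p q} → p ℕ.≤ q → radius p ≤ radius q
  radius-mono-≤ p≤q = go (ℕ.≤⇒≤′ p≤q)
    where
    go : ∀ {p q} → p ℕ.≤′ q → radius p ≤ radius q
    go (ℕ.≤′-reflexive refl) = ≤-refl
    go (ℕ.≤′-step {q} p≤q)   = ≤-trans (go p≤q) (<⇒≤ (radius-step q))

  radius-mono-< : ∀ {p q} → p ℕ.< q → radius p < radius q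
  radius-mono-< {p} p<q = <-≤-trans (radius-step p) (radius-mono-≤ p<q)

  1/radius-pos : ∀ q → Positive (1/radius q)
  1/radius-pos q = 1/pos⇒pos (radius q) {{radius-pos q}}

  ratio : ℕ → ℕ → ℚ
  ratio p q = 1/radius p * radius q

  ratio-≤ : ∀ p {q r} → q ℕ.≤ r → ratio p q ≤ ratio p r
  ratio-≤ p q≤r = *-monoˡ-≤-nonNeg (1/radius p) {{pos⇒nonNeg (1/radius p) {{1/radius-pos p}}}}
                                   (radius-mono-≤ q≤r)

  ratio-< : ∀ p {q r} → q ℕ.< r → ratio p q < ratio p r
  ratio-< p q<r = *-monoʳ-<-pos (1/radius p) {{1/radius-pos p}} (radius-mono-< q<r)

  ratio-refl : ∀ p → ratio p p ≡ 1ℚ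
  ratio-refl p = *-inverseˡ (radius p) {{radius-nonZero p}}

  -- Convex combinations.

  mix : ℚ → ℚ → ℚ → ℚ
  mix t a b = (1ℚ - t) * a + t * b

  mix-0 : ∀ a b → mix 0ℚ a b ≡ a
  mix-0 = solve 2 (λ a b → (con 1ℚ :- con 0ℚ) :* a :+ con 0ℚ :* b := a) refl
    where open +-*-Solver

  mix-1 : ∀ a b → mix 1ℚ a b ≡ b
  mix-1 = solve 2 (λ a b → (con 1ℚ :- con 1ℚ) :* a :+ con 1ℚ :* b := b) refl
    where open +-*-Solver

  mix-refl : ∀ t c → mix t c c ≡ c
  mix-refl = solve 2 (λ t c → (con 1ℚ :- t) :* c :+ t :* c := c) refl
    where open +-*-Solver

  mix-minus : ∀ t a b c d → mix t (a - c) (b - d) ≡ mix t a b - mix t c d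
  mix-minus = solve 5 (λ t a b c d → (con 1ℚ :- t) :* (a :- c) :+ t :* (b :- d)
    := ((con 1ℚ :- t) :* a :+ t :* b) :- ((con 1ℚ :- t) :* c :+ t :* d)) refl
    where open +-*-Solver

  p≤q⇒0≤q-p : ∀ {p q} → p ≤ q → 0ℚ ≤ q - p
  p≤q⇒0≤q-p {p} {q} p≤q = subst (_≤ q - p) (+-inverseʳ p) (+-monoˡ-≤ (- p) p≤q)

  p<q⇒0<q-p : ∀ {p q} → p < q → 0ℚ < q - p
  p<q⇒0<q-p {p} {q} p<q = subst (_< q - p) (+-inverseʳ p) (+-monoˡ-< (- p) p<q)

  module _ {t} (0≤t : 0ℚ ≤ t) (t≤1 : t ≤ 1ℚ) where
    private
      s≥0 = nonNegative (p≤q⇒0≤q-p t≤1)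
      t≥0 = nonNegative 0≤t

    mix-mono : ∀ {a b a′ b′} → a ≤ a′ → b ≤ b′ → mix t a b ≤ mix t a′ b′
    mix-mono a≤ b≤ = +-mono-≤ (*-monoˡ-≤-nonNeg (1ℚ - t) {{s≥0}} a≤) (*-monoˡ-≤-nonNeg t {{t≥0}} b≤)

    mix-≤ : ∀ {a b c} → a ≤ c → b ≤ c → mix t a b ≤ c
    mix-≤ a≤c b≤c = subst (_ ≤_) (mix-refl t _) (mix-mono a≤c b≤c)

    mix-≥ : ∀ {a b c} → c ≤ a → c ≤ b → c ≤ mix t a b
    mix-≥ c≤a c≤b = subst (_≤ _) (mix-refl t _) (mix-mono c≤a c≤b)

    -- If `t < 1`, then `a` has positive weight and pulls the mean strictly below `c`.
    t≡1-by : ∀ {a b c} → a < c → b ≤ c → c ≤ mix t a b → t ≡ 1ℚ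
    t≡1-by {a} {b} {c} a<c b≤c c≤mix = ≤-antisym t≤1 (≮⇒≥ λ t<1 →
      <-irrefl refl (<-≤-trans (mix<c t<1) c≤mix))
      where
      mix<c : t < 1ℚ → mix t a b < c
      mix<c t<1 = subst (mix t a b <_) (mix-refl t c) (+-mono-<-≤
        (*-monoʳ-<-pos (1ℚ - t) {{positive (p<q⇒0<q-p t<1)}} a<c)
        (*-monoˡ-≤-nonNeg t {{t≥0}} b≤c))

    t≡0-by : ∀ {a b c} → c ≤ a → c < b → mix t a b ≤ c → t ≡ 0ℚ
    t≡0-by {a} {b} {c} c≤a c<b mix≤c = ≤-antisym (≮⇒≥ λ 0<t →
      <-irrefl refl (<-≤-trans (c<mix 0<t) mix≤c)) 0≤t
      where
      c<mix : 0ℚ < t → c < mix t a b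
      c<mix 0<t = subst (_< mix t a b) (mix-refl t c) (+-mono-≤-<
        (*-monoˡ-≤-nonNeg (1ℚ - t) {{s≥0}} c≤a)
        (*-monoʳ-<-pos t {{positive 0<t}} c<b))

  -- The boundary of the octant and its projection to the plane.

  Vector : Set
  Vector = Fin 3 → ℚ

  spike : Fin 3 → ℚ → Vector
  spike a q c = if does (a Fin.≟ c) then q else 0ℚ

  segment : ℚ → Vector → Vector → Vector
  segment t x y c = mix t (x c) (y c)

  dot : Vector → Vector → ℚ
  dot w x = w zero * x zero + w (suc zero) * x (suc zero) + w (suc (suc zero)) * x (suc (suc zero))

  dot-cong : ∀ w {x y} → (∀ c → x c ≡ y c) → dot w x ≡ dot w y
  dot-cong w x≡y = cong₂ _+_ (cong₂ _+_ (cong (w zero *_) (x≡y zero))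
    (cong (w (suc zero) *_) (x≡y (suc zero)))) (cong (w (suc (suc zero)) *_) (x≡y (suc (suc zero))))

  dot-spike : ∀ w a q → dot w (spike a q) ≡ w a * q
  dot-spike w zero q = solve 4 (λ a b c q → a :* q :+ b :* con 0ℚ :+ c :* con 0ℚ := a :* q) refl
    (w zero) (w (suc zero)) (w (suc (suc zero))) q
    where open +-*-Solver
  dot-spike w (suc zero) q = solve 4 (λ a b c q → a :* con 0ℚ :+ b :* q :+ c :* con 0ℚ := b :* q) refl
    (w zero) (w (suc zero)) (w (suc (suc zero))) q
    where open +-*-Solver
  dot-spike w (suc (suc zero)) q = solve 4 (λ a b c q → a :* con 0ℚ :+ b :* con 0ℚ :+ c :* q := c :* q) refl
    (w zero) (w (suc zero)) (w (suc (suc zero))) q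
    where open +-*-Solver

  dot-segment : ∀ w t x y → dot w (segment t x y) ≡ mix t (dot w x) (dot w y)
  dot-segment w t x y = solve 11 (λ s t w₀ w₁ w₂ x₀ x₁ x₂ y₀ y₁ y₂ →
    w₀ :* (s :* x₀ :+ t :* y₀) :+ w₁ :* (s :* x₁ :+ t :* y₁) :+ w₂ :* (s :* x₂ :+ t :* y₂)
    := s :* (w₀ :* x₀ :+ w₁ :* x₁ :+ w₂ :* x₂) :+ t :* (w₀ :* y₀ :+ w₁ :* y₁ :+ w₂ :* y₂)) refl
    (1ℚ - t) t (w zero) (w (suc zero)) (w (suc (suc zero)))
    (x zero) (x (suc zero)) (x (suc (suc zero))) (y zero) (y (suc zero)) (y (suc (suc zero)))
    where open +-*-Solver

  -- The projection along (1, 1, 1), which maps the boundary of the octant onto ℚ²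
  -- and its edges onto the three rays.
  plane : Vector → Point
  plane x = x zero - x (suc (suc zero)) , x (suc zero) - x (suc (suc zero))

  OnBoundary : Vector → Set
  OnBoundary x = (∀ c → 0ℚ ≤ x c) × ∃[ c ] x c ≡ 0ℚ

  plane-cong : ∀ {x y} → (∀ c → x c ≡ y c) → plane x ≡ plane y
  plane-cong x≡y = cong₂ _,_ (cong₂ _-_ (x≡y zero) (x≡y (suc (suc zero))))
                             (cong₂ _-_ (x≡y (suc zero)) (x≡y (suc (suc zero))))

  -- Points with equal projections differ by `δ` times (1, 1, 1). At a zero coordinate of `y`,
  -- `x ≥ 0` gives `0 ≤ δ`; at a zero coordinate of `x`, `y ≥ 0` gives `δ ≤ 0`.
  plane-injective : ∀ {x y} → OnBoundary x → OnBoundary y → plane x ≡ plane y → ∀ c → x c ≡ y c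
  plane-injective {x} {y} (x≥0 , a , xa≡0) (y≥0 , b , yb≡0) eq c =
    trans (shift c) (trans (cong (y c +_) δ≡0) (+-identityʳ (y c)))
    where
    x₂ = x (suc (suc zero))
    y₂ = y (suc (suc zero))
    δ  = x₂ - y₂
    move : ∀ p q r s → p - q ≡ r - s → p ≡ r + (q - s)
    move p q r s e = begin
      p                ≡⟨ solve 2 (λ p q → p := (p :- q) :+ q) refl p q ⟩
      (p - q) + q      ≡⟨ cong (_+ q) e ⟩
      (r - s) + q      ≡⟨ solve 3 (λ q r s → (r :- s) :+ q := r :+ (q :- s)) refl q r s ⟩
      r + (q - s)      ∎
      where
      open ≡-Reasoning
      open +-*-Solver
    shift : ∀ c → x c ≡ y c + δ
    shift zero             = move (x zero) x₂ (y zero) y₂ (proj₁ (,-injective eq))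
    shift (suc zero)       = move (x (suc zero)) x₂ (y (suc zero)) y₂ (proj₂ (,-injective eq))
    shift (suc (suc zero)) = solve 2 (λ p q → p := q :+ (p :- q)) refl x₂ y₂
      where open +-*-Solver
    0≤δ : 0ℚ ≤ δ
    0≤δ = subst (0ℚ ≤_) (trans (shift b) (trans (cong (_+ δ) yb≡0) (+-identityˡ δ))) (x≥0 b)
    δ≤0 : δ ≤ 0ℚ
    δ≤0 = subst₂ _≤_ (+-identityˡ δ) (trans (sym (shift a)) xa≡0) (+-monoˡ-≤ δ (y≥0 a))
    δ≡0 = ≤-antisym δ≤0 0≤δ

  spike-≥0 : ∀ a {q} → 0ℚ ≤ q → ∀ c → 0ℚ ≤ spike a q c
  spike-≥0 a 0≤q c with does (a Fin.≟ c)
  ... | true  = 0≤q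
  ... | false = ≤-refl

  -- Any two axes lie in a common face of the octant, on which the coordinate `c` vanishes.
  thirdRay : ∀ a b → ∃[ c ] (∀ q → spike a q c ≡ 0ℚ) × (∀ r → spike b r c ≡ 0ℚ)
  thirdRay zero             zero             = suc zero       , (λ _ → refl) , λ _ → refl
  thirdRay zero             (suc zero)       = suc (suc zero) , (λ _ → refl) , λ _ → refl
  thirdRay zero             (suc (suc zero)) = suc zero       , (λ _ → refl) , λ _ → refl
  thirdRay (suc zero)       zero             = suc (suc zero) , (λ _ → refl) , λ _ → refl
  thirdRay (suc zero)       (suc zero)       = zero           , (λ _ → refl) , λ _ → refl
  thirdRay (suc zero)       (suc (suc zero)) = zero           , (λ _ → refl) , λ _ → refl
  thirdRay (suc (suc zero)) zero             = suc zero       , (λ _ → refl) , λ _ → refl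
  thirdRay (suc (suc zero)) (suc zero)       = zero           , (λ _ → refl) , λ _ → refl
  thirdRay (suc (suc zero)) (suc (suc zero)) = zero           , (λ _ → refl) , λ _ → refl

  -- Vertices in space and the gauges that separate them.

  vertex : ℕ → Vector
  vertex v = spike (ray v) (radius (suc (level v)))

  -- Makes `plane-injective` applicable to edges: a point of a drawn edge has only one lift to the
  -- boundary.
  segment-onBoundary : ∀ i j {t} → 0ℚ ≤ t → t ≤ 1ℚ → OnBoundary (segment t (vertex i) (vertex j))
  segment-onBoundary i j {t} 0≤t t≤1 =
    (λ c → mix-≥ 0≤t t≤1 (vertex-≥0 i c) (vertex-≥0 j c)) ,
    (c , trans (cong₂ (mix t) (i≡0 _) (j≡0 _)) (mix-refl t 0ℚ))
    where
    c   = proj₁ (thirdRay (ray i) (ray j))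
    i≡0 = proj₁ (proj₂ (thirdRay (ray i) (ray j)))
    j≡0 = proj₂ (proj₂ (thirdRay (ray i) (ray j)))
    vertex-≥0 : ∀ v c → 0ℚ ≤ vertex v c
    vertex-≥0 v = spike-≥0 (ray v)
      (<⇒≤ (positive⁻¹ (radius (suc (level v))) {{radius-pos (suc (level v))}}))

  -- Reciprocals of axis intercepts: the plane on which the gauge is 1 meets axis `c` at
  -- `radius (below m c)`, the radius of the last vertex before `m` on that ray, if there is one.
  slope : ℕ → Vector
  slope m c = 1/radius (below m c)

  -- Equal to 1 on the vertices m - 3, m - 2 and m - 1, which bound one of the nested
  -- triangles.  The level of vertex v is shifted by one, that is, to level (3 + v), so
  -- that gauge m makes sense for m < 3.
  gauge : ℕ → Vector → ℚ
  gauge m = dot (slope m)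

  height : ℕ → ℕ → ℚ
  height m v = gauge m (vertex v)

  height-ratio : ∀ m v → height m v ≡ ratio (below m (ray v)) (suc (level v))
  height-ratio m v = dot-spike (slope m) (ray v) (radius (suc (level v)))

  module _ (m v : ℕ) where
    private b = below m (ray v)

    -- The next vertex on the ray of `v` is `3 + v`, and `level (3 + v)` reduces to `suc (level v)`,
    -- the level at which `v` is drawn. Comparing `3 + v` with `m` therefore decides on which side
    -- of 1 the height falls.
    height<1 : 3 ℕ.+ v ℕ.< m → height m v < 1ℚ
    height<1 p = subst₂ _<_ (sym (height-ratio m v)) (ratio-refl b)
                            (ratio-< b (<⇒level< {3 ℕ.+ v} p))

    height≤1 : v ℕ.< m → height m v ≤ 1ℚ
    height≤1 p = subst₂ _≤_ (sym (height-ratio m v)) (ratio-refl b) (ratio-≤ b (<⇒level< p))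

    height≥1 : m ℕ.≤ 3 ℕ.+ v → 1ℚ ≤ height m v
    height≥1 p = subst₂ _≤_ (ratio-refl b) (sym (height-ratio m v))
                            (ratio-≤ b (≤⇒≤level {3 ℕ.+ v} p))

    height>1 : m ℕ.≤ v → 1ℚ < height m v
    height>1 p = subst₂ _<_ (ratio-refl b) (sym (height-ratio m v))
                            (ratio-< b (s≤s (≤⇒≤level {v} p)))

  -- Drawn edges and where they can meet.

  place : ℕ → Point
  place v = plane (vertex v)

  -- The position is given through the lifted segment, on which gauges are linear. The case `i = j`
  -- is allowed, so that a single vertex counts as a chord.
  record OnChord (i j : ℕ) (p : Point) : Set where
    constructor onChord
    field
      weight   : ℚ
      weight≥0 : 0ℚ ≤ weight
      weight≤1 : weight ≤ 1ℚ
      position : p ≡ plane (segment weight (vertex i) (vertex j))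

    boundary : OnBoundary (segment weight (vertex i) (vertex j))
    boundary = segment-onBoundary i j weight≥0 weight≤1

    at-start : weight ≡ 0ℚ → p ≡ place i
    at-start eq = trans position (plane-cong λ c →
      trans (cong (λ t → mix t (vertex i c) (vertex j c)) eq) (mix-0 (vertex i c) (vertex j c)))

    at-end : weight ≡ 1ℚ → p ≡ place j
    at-end eq = trans position (plane-cong λ c →
      trans (cong (λ t → mix t (vertex i c) (vertex j c)) eq) (mix-1 (vertex i c) (vertex j c)))

  open OnChord

  onSegment⇒onChord : ∀ i j {p} → OnSegment (place i) (place j) p → OnChord i j p
  onSegment⇒onChord i j (t , t≥0 , t≤1 , px , py) = onChord t t≥0 t≤1 (cong₂ _,_
    (trans px (mix-minus t (vertex i zero) (vertex j zero) _ _))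
    (trans py (mix-minus t (vertex i (suc zero)) (vertex j (suc zero)) _ _)))

  place-onChord : ∀ v → OnChord v v (place v)
  place-onChord v = onChord 0ℚ ≤-refl (<⇒≤ (positive⁻¹ 1ℚ))
    (plane-cong λ c → sym (mix-0 (vertex v c) (vertex v c)))

  chordHeight : ∀ {i j p} → ℕ → OnChord i j p → ℚ
  chordHeight {i} {j} m on = mix (weight on) (height m i) (height m j)

  -- Both lifts of `p` lie on the boundary of the octant and hence coincide, so the gauge depends on
  -- `p` alone.
  chordHeight-unique : ∀ {i j k l p} m (on : OnChord i j p) (on′ : OnChord k l p) →
                       chordHeight m on ≡ chordHeight m on′
  chordHeight-unique {i} {j} {k} {l} m on on′ = begin
    chordHeight m on
      ≡⟨ dot-segment (slope m) (weight on) (vertex i) (vertex j) ⟨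
    gauge m (segment (weight on) (vertex i) (vertex j))
      ≡⟨ dot-cong (slope m) same ⟩
    gauge m (segment (weight on′) (vertex k) (vertex l))
      ≡⟨ dot-segment (slope m) (weight on′) (vertex k) (vertex l) ⟩
    chordHeight m on′
      ∎
    where
    open ≡-Reasoning
    same = plane-injective (boundary on) (boundary on′)
                           (trans (sym (position on)) (position on′))

  module _ {i j p} (m : ℕ) (on : OnChord i j p) where

    chordHeight≤1 : height m i ≤ 1ℚ → height m j ≤ 1ℚ → chordHeight m on ≤ 1ℚ
    chordHeight≤1 = mix-≤ (weight≥0 on) (weight≤1 on)

    chordHeight≥1 : 1ℚ ≤ height m i → 1ℚ ≤ height m j → 1ℚ ≤ chordHeight m on
    chordHeight≥1 = mix-≥ (weight≥0 on) (weight≤1 on)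

    touches-end : height m i < 1ℚ → height m j ≤ 1ℚ → 1ℚ ≤ chordHeight m on → p ≡ place j
    touches-end hi hj h = at-end on (t≡1-by (weight≥0 on) (weight≤1 on) hi hj h)

    touches-start : 1ℚ ≤ height m i → 1ℚ < height m j → chordHeight m on ≤ 1ℚ → p ≡ place i
    touches-start hi hj h = at-start on (t≡0-by (weight≥0 on) (weight≤1 on) hi hj h)

  height-unique : ∀ {k l} m v (on : OnChord k l (place v)) → height m v ≡ chordHeight m on
  height-unique m v on =
    trans (sym (mix-0 (height m v) (height m v))) (chordHeight-unique m (place-onChord v) on)

  -- `gauge (3 + w)` tells the two apart: it is below 1 at `v` and at least 1 at `w`.
  place-< : ∀ {v w} → v ℕ.< w → place v ≢ place w
  place-< {v} {w} v<w eq = <-irrefl (height-unique (3 ℕ.+ w) v on)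
      (<-≤-trans (height<1 (3 ℕ.+ w) v (ℕ.+-monoʳ-< 3 v<w))
                 (chordHeight≥1 (3 ℕ.+ w) on h h))
    where
    on : OnChord w w (place v)
    on = subst (OnChord w w) (sym eq) (place-onChord w)
    h = height≥1 (3 ℕ.+ w) w ℕ.≤-refl

  place-injective : ∀ v w → place v ≡ place w → v ≡ w
  place-injective v w eq with ℕ.<-cmp v w
  ... | tri< v<w _ _ = contradiction eq (place-< v<w)
  ... | tri≈ _ v≡w _ = v≡w
  ... | tri> _ _ w<v = contradiction (sym eq) (place-< w<v)

  -- If `w < k`, `gauge (3 + k)` is below 1 at `w` but not on the chord. If `l < w`, `gauge w`
  -- exceeds 1 at `w` but not on the chord. In between, `gauge l` is at most 1 at `w`, and on the
  -- chord only the start `k` can satisfy this.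
  place-onChord⇒end : ∀ {k l} w → k ℕ.< l → l ℕ.≤ 3 ℕ.+ k → OnChord k l (place w) → w ≡ k ⊎ w ≡ l
  place-onChord⇒end {k} {l} w k<l l≤3+k on with ℕ.<-cmp w k
  ... | tri< w<k _ _ = contradiction
    (<-≤-trans (height<1 (3 ℕ.+ k) w (ℕ.+-monoʳ-< 3 w<k))
               (chordHeight≥1 (3 ℕ.+ k) on (height≥1 (3 ℕ.+ k) k ℕ.≤-refl)
                                           (height≥1 (3 ℕ.+ k) l (ℕ.+-monoʳ-≤ 3 (ℕ.<⇒≤ k<l)))))
    (<-irrefl (height-unique (3 ℕ.+ k) w on))
  ... | tri≈ _ w≡k _ = inj₁ w≡k
  ... | tri> _ _ k<w with ℕ.<-cmp w l
  -- This case is impossible, but the argument yields `w ≡ k`, which is already one of the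
  -- alternatives.
  ...   | tri< w<l _ _ = inj₁ (place-injective w k
          (touches-start l on (height≥1 l k l≤3+k) (height>1 l l ℕ.≤-refl)
            (subst (_≤ 1ℚ) (height-unique l w on) (height≤1 l w w<l))))
  ...   | tri≈ _ w≡l _ = inj₂ w≡l
  ...   | tri> _ _ l<w = contradiction
          (≤-<-trans (chordHeight≤1 w on (height≤1 w k k<w) (height≤1 w l l<w))
                     (height>1 w w ℕ.≤-refl))
          (<-irrefl (sym (height-unique w w on)))

  module _ {i j k l p}
           (i<j : i ℕ.< j) (j≤3+i : j ℕ.≤ 3 ℕ.+ i) (k<l : k ℕ.< l) (l≤3+k : l ℕ.≤ 3 ℕ.+ k)
           (on : OnChord i j p) (on′ : OnChord k l p) where

    -- The triangle k, k + 1, k + 2 separates the two chords.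
    meet-at-end : i ℕ.< k → (j ≡ k ⊎ j ≡ l) × p ≡ place j
    meet-at-end i<k = place-onChord⇒end j k<l l≤3+k (subst (OnChord k l) p≡j on′) , p≡j
      where
      m = 3 ℕ.+ k
      -- Puts `i` strictly inside the triangle and, because `j ≤ 3 + i`, keeps `j` from lying
      -- outside it.
      3+i<m = ℕ.+-monoʳ-< 3 i<k
      p≡j = touches-end m on (height<1 m i 3+i<m) (height≤1 m j (ℕ.≤-<-trans j≤3+i 3+i<m))
        (subst (1ℚ ≤_) (sym (chordHeight-unique m on on′))
          (chordHeight≥1 m on′ (height≥1 m k ℕ.≤-refl)
                               (height≥1 m l (ℕ.+-monoʳ-≤ 3 (ℕ.<⇒≤ k<l)))))

    -- The triangle l - 3, l - 2, l - 1 separates the two chords.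
    meet-at-start : i ≡ k → j ℕ.< l → p ≡ place k
    meet-at-start refl j<l = touches-start l on′ (height≥1 l k l≤3+k) (height>1 l l ℕ.≤-refl)
      (subst (_≤ 1ℚ) (chordHeight-unique l on on′)
        (chordHeight≤1 l on (height≤1 l k k<l) (height≤1 l j j<l)))

open SpiralDrawing using
  ( place; place-<; place-injective; OnChord; onSegment⇒onChord; place-onChord⇒end
  ; meet-at-end; meet-at-start)

open import Data.Fin.Properties using (_≟_; any?; toℕ-inject₁; toℕ-fromℕ; toℕ-injective)
open import Data.List
  using ([]; _∷_; _++_; length; filter; map; cartesianProduct; allFin; tabulate)
open import Data.List.Membership.Propositional using (_∈_)
open import Data.List.Membership.Propositional.Properties using (∈-cartesianProduct⁺; ∈-allFin)
open import Data.List.Properties using (filter-++; length-++; map-tabulate)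
open import Data.List.Relation.Unary.All using ([]; lookup)
open import Data.List.Relation.Unary.All.Properties using (¬Any⇒All¬)
open import Data.List.Relation.Unary.AllPairs using ([]; _∷_)
open import Data.List.Relation.Unary.Any as Any using (here; there)
open import Data.List.Relation.Unary.Unique.Propositional using (Unique)
open import Data.Nat as ℕ using (ℕ; zero; suc; _≤_; _<_; _+_; _*_; _∸_; _<?_; z≤n; s≤s; s≤s⁻¹)
open import Data.Nat.Properties hiding (_≟_; _<?_)
open import Algebra.Properties.Monoid.Sum +-0-monoid using (sum; sum-cong-≗; sum-replicate-zero)
open import Data.List.Extrema ≤-totalOrder using (argmax; f[xs]≤f[argmax])
open import Function using (_∘_; _⇔_; mk⇔; Equivalence)
open import Level using (0ℓ)
open import Relation.Binary.Construct.Closure.ReflexiveTransitive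
  using (Star; ε; _◅_; _◅◅_; gmap; reverse)
open import Relation.Nullary.Decidable using (_×-dec_; _⊎-dec_; does-⇔)
open import Relation.Unary using (Pred; Decidable)

-- Existence of distances and of the diameter.

leastWitness : {P : ℕ → Set} → (∀ k → Dec (P k)) → ∀ k → P k →
               ∃[ d ] P d × (∀ j → P j → d ≤ j)
leastWitness P? zero    p = zero , p , λ _ _ → z≤n
leastWitness P? (suc k) p with P? zero
... | yes p₀ = zero , p₀ , λ _ _ → z≤n
... | no ¬p₀ with leastWitness (P? ∘ suc) k p
...   | d , pd , least = suc d , pd , λ
        { zero    p₀ → contradiction p₀ ¬p₀
        ; (suc j) pj → s≤s (least j pj) }

module _ {n : ℕ} (G : Graph n) where
  open Graph G

  pathFrom : ∀ {u v x} (w : Walk G u v) → Unique (vertices G w) →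
             x ∈ vertices G w → ∃[ p ] pathLength G {x} {v} p ≤ walkLength G w
  pathFrom ε       un       (here refl) = record { walk = ε ; distinct = un } , z≤n
  pathFrom (e ◅ w) un       (here refl) = record { walk = e ◅ w ; distinct = un } , ≤-refl
  pathFrom (e ◅ w) (_ ∷ un) (there x∈w) = map₂ m≤n⇒m≤1+n (pathFrom w un x∈w)

  eraseLoops : ∀ {u v} (w : Walk G u v) → ∃[ p ] pathLength G {u} {v} p ≤ walkLength G w
  eraseLoops ε = record { walk = ε ; distinct = [] ∷ [] } , z≤n
  eraseLoops {u} (e ◅ w) with eraseLoops w
  ... | p , p≤w with Any.any? (u ≟_) (vertices G (Path.walk p))
  ...   | yes u∈p = map₂ (λ q≤p → m≤n⇒m≤1+n (≤-trans q≤p p≤w))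
                         (pathFrom (Path.walk p) (Path.distinct p) u∈p)
  ...   | no  u∉p = record { walk     = e ◅ Path.walk p
                           ; distinct = ¬Any⇒All¬ _ u∉p ∷ Path.distinct p }
                  , s≤s p≤w

  -- Walks instead of paths: without distinctness, existence is decidable by recursion on the
  -- length.
  WalkOfLength : ℕ → Fin n → Fin n → Set
  WalkOfLength k u v = ∃[ w ] walkLength G {u} {v} w ≡ k

  walkOfLength? : ∀ k u v → Dec (WalkOfLength k u v)
  walkOfLength? zero    u v = map′ (λ { refl → ε , refl }) (λ { (ε , _) → refl }) (u ≟ v)
  walkOfLength? (suc k) u v = map′
    (λ { (_ , e , w , refl) → e ◅ w , refl })
    (λ { (e ◅ w , refl) → _ , e , w , refl })
    (any? λ x → (u ~? x) ×-dec walkOfLength? k x v)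

  -- A shortest walk gives the distance: erasing loops turns it into a path that is no longer, and
  -- every path is a walk.
  distanceExists : Connected G → ∀ u v → ∃ (IsDistance G u v)
  distanceExists conn u v
    with leastWitness (λ k → walkOfLength? k u v) _ (Path.walk (conn u v) , refl)
  ... | d , (w , refl) , least =
        d , (p , ≤-antisym p≤w (minimal p)) , minimal
    where
    p   = proj₁ (eraseLoops w)
    p≤w = proj₂ (eraseLoops w)
    minimal : (q : Path G u v) → d ≤ pathLength G q
    minimal q = least _ (Path.walk q , refl)

maximiser : ∀ {n} (f : Fin (suc n) × Fin (suc n) → ℕ) → ∃[ p ] (∀ u v → f (u , v) ≤ f p)
maximiser {n} f = argmax f (zero , zero) pairs , λ u v →
  lookup (f[xs]≤f[argmax] {f = f} (zero , zero) pairs)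
         (∈-cartesianProduct⁺ (∈-allFin u) (∈-allFin v))
  where
  pairs = cartesianProduct (allFin (suc n)) (allFin (suc n))

diameterExists : ∀ {n} (G : Graph (suc n)) → Connected G → ∃ (IsDiameter G)
diameterExists G conn = fromMaximiser (maximiser (λ (u , v) → proj₁ (dist u v)))
  where
  dist = distanceExists G conn
  fromMaximiser : ∃[ p ] (∀ u v → proj₁ (dist u v) ≤ proj₁ (dist (proj₁ p) (proj₂ p))) →
                  ∃ (IsDiameter G)
  fromMaximiser ((x , y) , maximal) =
    proj₁ (dist x y) , (x , y , proj₂ (dist x y)) , λ u v d (_ , minimal) →
      -- The minimality of `d` is applied to the path that realises the chosen distance from `u` to
      -- `v`.
      let (p , len) , _ = proj₂ (dist u v)
      in ≤-trans (subst (_ ≤_) len (minimal p)) (maximal u v)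

-- The family of graphs.

-- The edges {i, 2 + i} and {i, 3 + i} come in the order {0, 2}, {0, 3}, {1, 3},
-- {1, 4}, {2, 4}, …; the first e of them are present.
Chord : ℕ → ℕ → ℕ → Set
Chord e i j = j ≡ 1 + i ⊎ (j ≡ 2 + i × i * 2 < e) ⊎ (j ≡ 3 + i × 1 + i * 2 < e)

chord? : ∀ e i j → Dec (Chord e i j)
chord? e i j = (j ℕ.≟ 1 + i) ⊎-dec ((j ℕ.≟ 2 + i) ×-dec (i * 2 <? e))
                           ⊎-dec ((j ℕ.≟ 3 + i) ×-dec (1 + i * 2 <? e))

chord⇒< : ∀ {e i j} → Chord e i j → i < j
chord⇒< (inj₁ refl)              = ≤-refl
chord⇒< (inj₂ (inj₁ (refl , _))) = m≤n+m _ 1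
chord⇒< (inj₂ (inj₂ (refl , _))) = m≤n+m _ 2

chord⇒≤3+ : ∀ {e i j} → Chord e i j → j ≤ 3 + i
chord⇒≤3+ (inj₁ refl)              = m≤n+m _ 2
chord⇒≤3+ (inj₂ (inj₁ (refl , _))) = m≤n+m _ 1
chord⇒≤3+ (inj₂ (inj₂ (refl , _))) = ≤-refl

chordGraph : ∀ {n} → ℕ → Graph n
chordGraph e = record
  { _~_      = λ u v → Chord e (toℕ u) (toℕ v) ⊎ Chord e (toℕ v) (toℕ u)
  ; ~-sym    = swap
  ; ~-irrefl = λ { refl (inj₁ c) → <-irrefl refl (chord⇒< c)
                 ; refl (inj₂ c) → <-irrefl refl (chord⇒< c) }
  ; _~?_     = λ u v → chord? e (toℕ u) (toℕ v) ⊎-dec chord? e (toℕ v) (toℕ u)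
  }

edge⇒chord : ∀ {n e} {u v : Fin n} → IsEdge (chordGraph e) (u , v) → Chord e (toℕ u) (toℕ v)
edge⇒chord (u<v , inj₁ c) = c
edge⇒chord (u<v , inj₂ c) = contradiction u<v (<-asym (chord⇒< c))

chain : ∀ {n} {R : Rel (Fin (suc n)) 0ℓ} → (∀ i → R (inject₁ i) (suc i)) → ∀ v → Star R zero v
chain             step zero    = ε
chain {n = suc _} step (suc v) = step zero ◅ gmap suc (λ r → r) (chain (step ∘ suc) v)

chordGraph-connected : ∀ {n} e → Connected (chordGraph {n} e)
chordGraph-connected {suc n} e u v =
  proj₁ (eraseLoops (chordGraph e) (reverse swap (fromZero u) ◅◅ fromZero v))
  where
  fromZero : ∀ v → Walk (chordGraph e) zero v
  fromZero = chain (λ i → inj₁ (inj₁ (cong suc (sym (toℕ-inject₁ i)))))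

-- A potential that bounds walk lengths from below.

-- The edges {i, 2 + i} and {i, 3 + i} end at vertices v with 2 v ≤ 4 + e; from there on
-- each of the remaining edges {i, 1 + i} may add 3.
potential : ℕ → ℕ → ℕ
potential e v = v + (v * 2 ∸ (4 + e))

-- Lets a walk traverse an edge backwards without raising the potential.
chord-potential-mono : ∀ {e i j} → Chord e i j → potential e i ≤ potential e j
chord-potential-mono {e} c = +-mono-≤ i≤j (∸-monoˡ-≤ (4 + e) (*-monoˡ-≤ 2 i≤j))
  where i≤j = <⇒≤ (chord⇒< c)

-- On a path edge, `v` grows by 1 and the truncated term by at most 2. On a longer edge, the
-- truncated term is 0 at the far end, so only the growth of `v`, by 2 or 3, counts.
chord-potential-step : ∀ {e i j} → Chord e i j → potential e j ≤ 3 + potential e i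
chord-potential-step {e} {i} (inj₁ refl) = begin
  1 + i + (2 + i * 2 ∸ c)
    ≤⟨ +-monoʳ-≤ (1 + i) (m≤n+o⇒m∸n≤o (2 + i * 2) c bound) ⟩
  1 + i + (2 + (i * 2 ∸ c))    ≡⟨ +-suc (1 + i) (1 + (i * 2 ∸ c)) ⟩
  2 + (i + (1 + (i * 2 ∸ c)))  ≡⟨ cong (2 +_) (+-suc i (i * 2 ∸ c)) ⟩
  3 + (i + (i * 2 ∸ c))        ∎
  where
  open ≤-Reasoning
  c = 4 + e
  bound : 2 + i * 2 ≤ c + (2 + (i * 2 ∸ c))
  bound = begin
    2 + i * 2                    ≤⟨ +-monoʳ-≤ 2 (m≤n+m∸n (i * 2) c) ⟩
    2 + (c + (i * 2 ∸ c))        ≡⟨ cong suc (+-suc c (i * 2 ∸ c)) ⟨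
    1 + (c + (1 + (i * 2 ∸ c)))  ≡⟨ +-suc c (1 + (i * 2 ∸ c)) ⟨
    c + (2 + (i * 2 ∸ c))        ∎
chord-potential-step {e} {i} (inj₂ (inj₁ (refl , p))) = begin
  2 + i + (i * 2 ∸ e)  ≡⟨ cong (2 + i +_) (m≤n⇒m∸n≡0 (<⇒≤ p)) ⟩
  2 + i + 0            ≤⟨ +-mono-≤ (n≤1+n (2 + i)) z≤n ⟩
  3 + potential e i    ∎
  where open ≤-Reasoning
chord-potential-step {e} {i} (inj₂ (inj₂ (refl , p))) = begin
  3 + i + (2 + i * 2 ∸ e)  ≡⟨ cong (3 + i +_) (m≤n⇒m∸n≡0 p) ⟩
  3 + i + 0                ≤⟨ +-monoʳ-≤ (3 + i) z≤n ⟩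
  3 + potential e i        ∎
  where open ≤-Reasoning

potential-walk : ∀ {n} e {u v : Fin n} (w : Walk (chordGraph e) u v) →
                 potential e (toℕ v) ≤ walkLength (chordGraph e) w * 3 + potential e (toℕ u)
potential-walk e ε = ≤-refl
potential-walk e {u} {v} (_◅_ {_} {x} s w) = begin
  potential e (toℕ v)                         ≤⟨ potential-walk e w ⟩
  ℓ * 3 + potential e (toℕ x)                 ≤⟨ +-monoʳ-≤ (ℓ * 3) (edge s) ⟩
  ℓ * 3 + (3 + potential e (toℕ u))           ≡⟨ +-assoc (ℓ * 3) 3 _ ⟨
  ℓ * 3 + 3 + potential e (toℕ u)             ≡⟨ cong (_+ potential e (toℕ u)) (+-comm (ℓ * 3) 3) ⟩
  (1 + ℓ) * 3 + potential e (toℕ u)           ∎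
  where
  open ≤-Reasoning
  ℓ = walkLength (chordGraph e) w
  edge : Graph._~_ (chordGraph e) u x → potential e (toℕ x) ≤ 3 + potential e (toℕ u)
  edge (inj₁ c) = chord-potential-step c
  edge (inj₂ c) = ≤-trans (chord-potential-mono c) (m≤n+m _ 3)

-- Counting edges.

indicator : {A : Set} → Dec A → ℕ
indicator a? = if does a? then 1 else 0

length-filter-tabulate : ∀ {n} {A : Set} {P : Pred A 0ℓ} (P? : Decidable P) (f : Fin n → A) →
  length (filter P? (tabulate f)) ≡ sum (λ i → indicator (P? (f i)))
length-filter-tabulate {zero}  P? f = refl
length-filter-tabulate {suc n} P? f with ih ← length-filter-tabulate P? (f ∘ suc) | P? (f zero)
... | yes _ = cong suc ih
... | no  _ = ih

length-filter-cartesianProduct :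
  ∀ {m n} {A B : Set} {P : Pred (A × B) 0ℓ} (P? : Decidable P) (f : Fin m → A) (g : Fin n → B) →
  length (filter P? (cartesianProduct (tabulate f) (tabulate g)))
    ≡ sum (λ i → sum (λ j → indicator (P? (f i , g j))))
length-filter-cartesianProduct {zero}  P? f g = refl
length-filter-cartesianProduct {suc m} P? f g = begin
  length (filter P? (row ++ rest))                    ≡⟨ cong length (filter-++ P? row rest) ⟩
  length (filter P? row ++ filter P? rest)            ≡⟨ length-++ (filter P? row) ⟩
  length (filter P? row) + length (filter P? rest)
    ≡⟨ cong₂ _+_
         (trans (cong (length ∘ filter P?) (map-tabulate g (f zero ,_)))
                (length-filter-tabulate P? ((f zero ,_) ∘ g)))
         (length-filter-cartesianProduct P? (f ∘ suc) g) ⟩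
  sum (λ i → sum (λ j → indicator (P? (f i , g j))))  ∎
  where
  open ≡-Reasoning
  row  = map (f zero ,_) (tabulate g)
  rest = cartesianProduct (tabulate (f ∘ suc)) (tabulate g)

edgeIndicator : ∀ {n} → ℕ → Fin n → Fin n → ℕ
edgeIndicator e u v = indicator (isEdge? (chordGraph e) (u , v))

numEdges-sum : ∀ n e → numEdges (chordGraph {n} e) ≡ sum (λ u → sum (edgeIndicator {n} e u))
numEdges-sum n e = length-filter-cartesianProduct (isEdge? (chordGraph {n} e)) (λ u → u) (λ v → v)

-- Truncation does no harm: for `m < 2` both sides are false.
2+n<m⇔n<m∸2 : ∀ m n → 2 + n < m ⇔ n < m ∸ 2
2+n<m⇔n<m∸2 zero          n = mk⇔ (λ ()) (λ ())
2+n<m⇔n<m∸2 (suc zero)    n = mk⇔ (λ { (s≤s ()) }) (λ ())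
2+n<m⇔n<m∸2 (suc (suc m)) n = mk⇔ (λ { (s≤s (s≤s p)) → p }) (λ p → s≤s (s≤s p))

-- Vertex 0 owns the first two places, {0, 2} and {0, 3}, in the order of the longer edges, so
-- deleting it lowers `e` by 2.
chord-shift : ∀ e i j → Chord e (suc i) (suc j) ⇔ Chord (e ∸ 2) i j
chord-shift e i j = mk⇔
  (λ { (inj₁ refl)              → inj₁ refl
     ; (inj₂ (inj₁ (refl , p))) → inj₂ (inj₁ (refl , to (2+n<m⇔n<m∸2 e (i * 2)) p))
     ; (inj₂ (inj₂ (refl , p))) → inj₂ (inj₂ (refl , to (2+n<m⇔n<m∸2 e (1 + i * 2)) p)) })
  (λ { (inj₁ refl)              → inj₁ refl
     ; (inj₂ (inj₁ (refl , p))) → inj₂ (inj₁ (refl , from (2+n<m⇔n<m∸2 e (i * 2)) p))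
     ; (inj₂ (inj₂ (refl , p))) → inj₂ (inj₂ (refl , from (2+n<m⇔n<m∸2 e (1 + i * 2)) p)) })
  where open Equivalence

edgeIndicator-shift : ∀ {n} e (u v : Fin n) →
                      edgeIndicator e (suc u) (suc v) ≡ edgeIndicator (e ∸ 2) u v
edgeIndicator-shift e u v = cong (if_then 1 else 0)
  (does-⇔ (mk⇔ (λ (u<v , s) → s≤s⁻¹ u<v , Sum.map (to (shift u v)) (to (shift v u)) s)
               (λ (u<v , s) → s≤s u<v , Sum.map (from (shift u v)) (from (shift v u)) s))
          (isEdge? (chordGraph e) (suc u , suc v))
          (isEdge? (chordGraph (e ∸ 2)) (u , v)))
  where
  open Equivalence
  shift : ∀ u v → _
  shift u v = chord-shift e (toℕ u) (toℕ v)

-- Pairs with second entry `zero` violate `u < v`, and their indicators reduce to 0. The other rows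
-- form the graph without vertex 0.
numEdges-suc : ∀ n e → numEdges (chordGraph {suc n} e)
  ≡ sum {n} (λ v → edgeIndicator e zero (suc v)) + numEdges (chordGraph {n} (e ∸ 2))
numEdges-suc n e = trans (numEdges-sum (suc n) e) (cong (degree₀ +_)
  (trans (sum-cong-≗ {n} (λ u → sum-cong-≗ {n} (edgeIndicator-shift e u)))
         (sym (numEdges-sum n (e ∸ 2)))))
  where degree₀ = sum {n} (λ v → edgeIndicator e zero (suc v))

-- There are `k + 1` pairs {i, i + 2} and `k` pairs {i, i + 3}, so the hypothesis says that all `e`
-- longer edges fit. The induction deletes vertex 0, which has degree 1, 2 or 3 according to `e`.
numEdges-chordGraph : ∀ k e → e ≤ 1 + k * 2 → numEdges (chordGraph {3 + k} e) ≡ 2 + k + e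
numEdges-chordGraph zero    zero          _ = refl
numEdges-chordGraph zero    (suc zero)    _ = refl
numEdges-chordGraph zero    (suc (suc _)) (s≤s ())
numEdges-chordGraph (suc k) zero          _ = trans (numEdges-suc (3 + k) 0)
  -- The first three terms of the sum compute; the `k` remaining ones belong to vertices from 4 on,
  -- which are too far from 0.
  (cong suc (cong₂ _+_ (sum-replicate-zero k) (numEdges-chordGraph k 0 z≤n)))
numEdges-chordGraph (suc k) (suc zero)    _ = trans (numEdges-suc (3 + k) 1)
  (trans (cong (2 +_) (cong₂ _+_ (sum-replicate-zero k) (numEdges-chordGraph k 0 z≤n)))
         (cong suc (sym (+-suc (2 + k) 0))))
numEdges-chordGraph (suc k) (suc (suc e)) (s≤s (s≤s e≤)) = trans (numEdges-suc (3 + k) (2 + e))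
  (trans (cong (3 +_) (cong₂ _+_ (sum-replicate-zero k) (numEdges-chordGraph k e e≤)))
         (cong suc (sym (trans (+-suc (2 + k) (suc e)) (cong suc (+-suc (2 + k) e))))))

-- The diameter of the graphs.

chordGraph-diameter : ∀ k e {D} → IsDiameter (chordGraph {3 + k} e) D → 2 + k * 3 ≤ D * 3 + e
chordGraph-diameter k e {D} (_ , maximal) = begin
  2 + k * 3                        ≡⟨ cong (2 +_) (*-suc k 2) ⟩
  -- Valid whether or not `e` exceeds `k * 2`; the result is the potential of the last vertex
  -- `2 + k` plus `e`, while the potential at 0 is 0.
  2 + (k + k * 2)                  ≤⟨ +-monoʳ-≤ (2 + k) (m≤n+m∸n (k * 2) e) ⟩
  2 + k + (e + (k * 2 ∸ e))        ≡⟨ cong (2 + k +_) (+-comm e _) ⟩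
  2 + k + (k * 2 ∸ e + e)          ≡⟨ +-assoc (2 + k) (k * 2 ∸ e) e ⟨
  potential e (2 + k) + e          ≡⟨ cong (λ v → potential e v + e) (toℕ-fromℕ (2 + k)) ⟨
  potential e (toℕ last) + e       ≤⟨ +-monoˡ-≤ e (potential-walk e (Path.walk p)) ⟩
  pathLength G p * 3 + 0 + e       ≡⟨ cong (_+ e) (+-identityʳ _) ⟩
  pathLength G p * 3 + e           ≡⟨ cong (λ d → d * 3 + e) len ⟩
  d * 3 + e                        ≤⟨ +-monoˡ-≤ e (*-monoˡ-≤ 3 (maximal zero last d isDist)) ⟩
  D * 3 + e                        ∎
  where
  open ≤-Reasoning
  G = chordGraph {3 + k} e
  last = fromℕ (2 + k)
  distance = distanceExists G (chordGraph-connected e) zero last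
  d = proj₁ distance
  isDist = proj₂ distance
  p = proj₁ (proj₁ isDist)
  len = proj₂ (proj₁ isDist)

-- Planarity.

common-end : ∀ {i j k l p} → i < j → j ≤ 3 + i → k < l → l ≤ 3 + k →
             ¬ (i ≡ k × j ≡ l) → OnChord i j p → OnChord k l p →
             ∃[ w ] (w ≡ i ⊎ w ≡ j) × (w ≡ k ⊎ w ≡ l) × p ≡ place w
common-end {i} {j} {k} {l} {p} i<j j≤3+i k<l l≤3+k ij≢kl on on′ =
  compare (<-cmp i k) (<-cmp j l)
  where
  Common : Set
  Common = ∃[ w ] (w ≡ i ⊎ w ≡ j) × (w ≡ k ⊎ w ≡ l) × p ≡ place w

  -- The chord with the smaller start can meet the other only at its own far end; chords with equal
  -- starts meet only there.
  compare : Tri (i < k) (i ≡ k) (k < i) → Tri (j < l) (j ≡ l) (l < j) → Common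
  compare (tri< i<k _ _) _ =
    let j∈kl , p≡j = meet-at-end i<j j≤3+i k<l l≤3+k on on′ i<k
    in j , inj₂ refl , j∈kl , p≡j
  compare (tri> _ _ k<i) _ =
    let l∈ij , p≡l = meet-at-end k<l l≤3+k i<j j≤3+i on′ on k<i
    in l , l∈ij , inj₂ refl , p≡l
  compare (tri≈ _ i≡k _) (tri< j<l _ _) =
    k , inj₁ (sym i≡k) , inj₁ refl , meet-at-start i<j j≤3+i k<l l≤3+k on on′ i≡k j<l
  compare (tri≈ _ i≡k _) (tri> _ _ l<j) =
    i , inj₁ refl , inj₁ i≡k , meet-at-start k<l l≤3+k i<j j≤3+i on′ on (sym i≡k) l<j
  compare (tri≈ _ i≡k _) (tri≈ _ j≡l _) = contradiction (i≡k , j≡l) ij≢kl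

common-endpoint : ∀ {n} (u v x y : Fin n) {p} →
  ∃[ w ] (w ≡ toℕ u ⊎ w ≡ toℕ v) × (w ≡ toℕ x ⊎ w ≡ toℕ y) × p ≡ place w →
  ∃[ w ] (w ≡ u ⊎ w ≡ v) × (w ≡ x ⊎ w ≡ y) × p ≡ place (toℕ w)
common-endpoint u v x y (_ , inj₁ refl , end , eq) =
  u , inj₁ refl , Sum.map toℕ-injective toℕ-injective end , eq
common-endpoint u v x y (_ , inj₂ refl , end , eq) =
  v , inj₂ refl , Sum.map toℕ-injective toℕ-injective end , eq

module _ {n : ℕ} (e : ℕ) where
  private
    short : ∀ {u v : Fin n} → IsEdge (chordGraph e) (u , v) → toℕ v ≤ 3 + toℕ u
    short uv = chord⇒≤3+ (edge⇒chord uv)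

  chordGraph-planar : Planar (chordGraph {n} e)
  chordGraph-planar = record
    { pos            = λ u → place (toℕ u)
    ; pos-injective  = λ {u} {v} eq → toℕ-injective (place-injective (toℕ u) (toℕ v) eq)
    ; corners        = λ _ → []
    ; edge-arc       = λ _ _ uv → place-< (proj₁ uv)
    ; vertex-on-edge = λ { w (u , v) uv on → Sum.map toℕ-injective toℕ-injective
        (place-onChord⇒end (toℕ w) (proj₁ uv) (short uv)
          (onSegment⇒onChord (toℕ u) (toℕ v) on)) }
    ; no-crossing    = λ { (u , v) (x , y) uv xy uv≢xy p on on′ → common-endpoint u v x y
        (common-end (proj₁ uv) (short uv) (proj₁ xy) (short xy)
          (λ (u≡x , v≡y) → uv≢xy (cong₂ _,_ (toℕ-injective u≡x) (toℕ-injective v≡y)))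
          (onSegment⇒onChord (toℕ u) (toℕ v) on) (onSegment⇒onChord (toℕ x) (toℕ y) on′)) }
    }

-- Arithmetic of the bounds on edges and diameter.

chords-≤ : ∀ k e → 2 + k + e ≤ 3 * (3 + k) ∸ 6 → e ≤ 1 + k * 2
chords-≤ k e m≤ = +-cancelˡ-≤ (2 + k) e (1 + k * 2) (subst (2 + k + e ≤_) eq m≤)
  where
  open ≡-Reasoning
  eq : 3 * (3 + k) ∸ 6 ≡ 2 + k + (1 + k * 2)
  eq = begin
    -- With the factors exchanged, the product reduces to `9 + k * 3` and the subtraction computes.
    3 * (3 + k) ∸ 6        ≡⟨ cong (_∸ 6) (*-comm 3 (3 + k)) ⟩
    3 + k * 3              ≡⟨ cong (3 +_) (*-suc k 2) ⟩
    3 + (k + k * 2)        ≡⟨ cong (2 +_) (+-suc k (k * 2)) ⟨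
    2 + (k + (1 + k * 2))  ∎

-- Imported only here: with +_ in scope, sections such as (2 +_) are ambiguous.
open import Data.Integer as ℤ using (+_)
import Data.Integer.Properties as ℤ
open import Data.Integer.Solver using (module +-*-Solver)
open import Data.Rational as ℚ using (ℚ; toℚᵘ)
import Data.Rational.Properties as ℚ
open import Data.Rational.Unnormalised as ℚᵘ using (mkℚᵘ; *≤*)
import Data.Rational.Unnormalised.Properties as ℚᵘ

/3-≤ : ∀ a b c → a ℤ.- b ℤ.≤ c ℤ.* + 3 → a ℚ./ 3 ℚ.- b ℚ./ 3 ℚ.≤ c ℚ./ 1
/3-≤ a b c a-b≤3c = ℚ.toℚᵘ-cancel-≤ (begin
  toℚᵘ (a ℚ./ 3 ℚ.- b ℚ./ 3)
    ≃⟨ ℚ.toℚᵘ-homo-+ (a ℚ./ 3) (ℚ.- (b ℚ./ 3)) ⟩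
  toℚᵘ (a ℚ./ 3) ℚᵘ.+ toℚᵘ (ℚ.- (b ℚ./ 3))
    ≃⟨ ℚᵘ.+-cong (ℚ.toℚᵘ-fromℚᵘ (mkℚᵘ a 2))
                 (ℚᵘ.≃-trans (ℚ.toℚᵘ-homo‿- (b ℚ./ 3)) (ℚᵘ.-‿cong (ℚ.toℚᵘ-fromℚᵘ (mkℚᵘ b 2)))) ⟩
  mkℚᵘ a 2 ℚᵘ.- mkℚᵘ b 2
    ≤⟨ *≤* cross ⟩
  mkℚᵘ c 0
    ≃⟨ ℚ.toℚᵘ-fromℚᵘ (mkℚᵘ c 0) ⟨
  toℚᵘ (c ℚ./ 1)
    ∎)
  where
  open ℚᵘ.≤-Reasoning
  -- `mkℚᵘ` stores the denominator minus one, so the unnormalised difference has denominator 9, and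
  -- cross-multiplying leaves three times the hypothesis.
  cross : (a ℤ.* + 3 ℤ.+ (ℤ.- b) ℤ.* + 3) ℤ.* + 1 ℤ.≤ c ℤ.* + 9
  cross = subst₂ ℤ._≤_
    (solve 2 (λ a b → (a :- b) :* con (+ 3)
                   := (a :* con (+ 3) :+ (:- b) :* con (+ 3)) :* con (+ 1)) refl a b)
    (solve 1 (λ c → c :* con (+ 3) :* con (+ 3) := c :* con (+ 9)) refl c)
    (ℤ.*-monoʳ-≤-nonNeg (+ 3) a-b≤3c)
    where open +-*-Solver

-- For `n = 3 + k` and `m = 2 + k + e`, the numerator 4(n - 1) - m - 4 equals 2 + 3k - e; this is
-- where the constant 4/3 comes from.
diameterBound-≤ : ∀ k e D → 2 + k * 3 ≤ D * 3 + e →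
                  diameterBound (3 + k) (2 + k + e) ℚ.- (+ 4 ℚ./ 3) ℚ.≤ + D ℚ./ 1
diameterBound-≤ k e D le = /3-≤ (+ 4 ℤ.* (+ (3 + k) ℤ.- + 1) ℤ.- + (2 + k + e)) (+ 4) (+ D)
  (subst₂ ℤ._≤_
    (solve 2 (λ k e → (con (+ 2) :+ k :* con (+ 3)) :- e :=
       (con (+ 4) :* ((con (+ 3) :+ k) :- con (+ 1)) :- ((con (+ 2) :+ k) :+ e)) :- con (+ 4))
       refl (+ k) (+ e))
    (solve 2 (λ d e → (d :* con (+ 3) :+ e) :- e := d :* con (+ 3)) refl (+ D) (+ e))
    (ℤ.+-monoˡ-≤ (ℤ.- (+ e)) (subst₂ ℤ._≤_
       (cong (λ x → + 2 ℤ.+ x) (ℤ.pos-* k 3)) (cong (λ x → x ℤ.+ + e) (ℤ.pos-* D 3)) (ℤ.+≤+ le))))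
  where open +-*-Solver

chordGraph-bound : ∀ k e → ∃ (IsDiameter (chordGraph {3 + k} e)) → ∃ λ (D : ℕ) →
  IsDiameter (chordGraph {3 + k} e) D ×
  diameterBound (3 + k) (2 + k + e) ℚ.- (+ 4 ℚ./ 3) ℚ.≤ + D ℚ./ 1
chordGraph-bound k e (D , isDiam) =
  D , isDiam , diameterBound-≤ k e D (chordGraph-diameter k e {D} isDiam)

mainTheorem4 : ∃ λ (C : ℚ) →
    (n m : ℕ) → 3 ≤ n → n ∸ 1 ≤ m → m ≤ 3 * n ∸ 6 →
    Σ (Graph n) λ G →
    Connected G × Planar G × numEdges G ≡ m ×
    ∃ λ (D : ℕ) → IsDiameter G D × diameterBound n m ℚ.- C ℚ.≤ + D ℚ./ 1
mainTheorem4 = + 4 ℚ./ 3 , witness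
  where
  witness : ∀ n m → 3 ≤ n → n ∸ 1 ≤ m → m ≤ 3 * n ∸ 6 → Σ (Graph n) λ G →
    Connected G × Planar G × numEdges G ≡ m ×
    ∃ λ (D : ℕ) → IsDiameter G D × diameterBound n m ℚ.- (+ 4 ℚ./ 3) ℚ.≤ + D ℚ./ 1
  -- The excess of `m` over the `n - 1` path edges becomes the parameter `e`.
  witness (suc (suc (suc k))) m 3≤n n-1≤m m≤ = fromExcess (m≤n⇒∃[o]m+o≡n n-1≤m)
    where
    fromExcess : (∃[ e ] 2 + k + e ≡ m) → Σ (Graph (3 + k)) λ G →
      Connected G × Planar G × numEdges G ≡ m ×
      ∃ λ (D : ℕ) → IsDiameter G D × diameterBound (3 + k) m ℚ.- (+ 4 ℚ./ 3) ℚ.≤ + D ℚ./ 1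
    fromExcess (e , refl) = chordGraph e , chordGraph-connected e , chordGraph-planar e ,
      numEdges-chordGraph k e (chords-≤ k e m≤) ,
      chordGraph-bound k e (diameterExists (chordGraph e) (chordGraph-connected e))
  witness (suc (suc zero)) _ (s≤s (s≤s ())) _ _
  witness (suc zero)       _ (s≤s ())       _ _
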